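{- For a loopless multigraph with degeneracy $\delta$, arboricity $a$ and pseudo-arboricity $a^*$, there holds $a_{\text{star}}^{\text{list}} \leq 2 \delta \leq \min \{4 a^*, 4 a - 2 \}$.
   Context: The arboricity $a$ (respectively pseudo-arboricity $a^*$) is the minimum number of forests (respectively pseudo-forests, i.e. graphs with at most one cycle in each connected component) into which the edges of the graph can be partitioned. The degeneracy $\delta$ is the smallest integer such that every subgraph has a vertex of degree at most $\delta$ (degrees counted with multiplicity); equivalently, the smallest $\delta$ such that the edges have an acyclic orientation with all outdegrees at most $\delta$. A star-forest is a forest whose connected components are stars. If each edge $e$ has a palette (set) of colors $Q(e)$, a list-star-forest decomposition (LSFD) is a choice of color $\phi(e) \in Q(e)$ for every edge $e$ such that for each color $c$ the edges of color $c$ form a star-forest. $a_{\text{star}}^{\text{list}}$ is the smallest value $k$ such that an LSFD exists whenever each edge has a palette of size $k$.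
   Formalization: For a graph without edges (a = 0) the bound 4a − 2 would be −2 and the stated inequality fails; the formal statement reads 4a − 2 as 0 in that case and is literal for a ≥ 1. -}

module Defs where

open import Data.Nat using (ℕ; _≤_)
open import Data.Fin using (Fin; _≟_)
open import Data.Fin.Subset using (Subset; _∈_; _∩_; ∣_∣; Nonempty)
open import Data.List using (List; []; _∷_)
import Data.List.Membership.Propositional as List
open import Data.List.Relation.Unary.Unique.Propositional using (Unique)
open import Data.Product using (_×_; _,_; proj₁; proj₂; ∃; ∃-syntax)
open import Data.Sum using (_⊎_)
open import Data.Vec using (tabulate)
open import Function.Bundles using (_⇔_)
open import Level using (0ℓ)
open import Relation.Binary.PropositionalEquality using (_≡_; _≢_)
open import Relation.Nullary using (¬_; Dec; does)
open import Relation.Nullary.Decidable using (_⊎-dec_)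
open import Relation.Unary using (Pred)

IsLeast : Pred ℕ 0ℓ → ℕ → Set
IsLeast P k = P k × (∀ j → P j → k ≤ j)

-- Parallel edges are distinct indices with the same endpoints.  The order of
-- the two endpoints of an edge is immaterial: every notion below is symmetric.
record LooplessMultigraph : Set where
  field
    #V #E    : ℕ
    ends     : Fin #E → Fin #V × Fin #V
    loopless : ∀ e → proj₁ (ends e) ≢ proj₂ (ends e)

  Vertex Edge : Set
  Vertex = Fin #V
  Edge   = Fin #E

module _ (G : LooplessMultigraph) where
  open LooplessMultigraph G

  Incident : Vertex → Edge → Set
  Incident v e = v ≡ proj₁ (ends e) ⊎ v ≡ proj₂ (ends e)

  incident? : ∀ v e → Dec (Incident v e)
  incident? v e = (v ≟ proj₁ (ends e)) ⊎-dec (v ≟ proj₂ (ends e))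

  Joins : Edge → Vertex → Vertex → Set
  Joins e u v = ends e ≡ (u , v) ⊎ ends e ≡ (v , u)

  record Subgraph : Set where
    field
      vertices : Subset #V
      edges    : Subset #E
      closed   : ∀ {e v} → e ∈ edges → Incident v e → v ∈ vertices

  -- There are no loops, so counting incident edges is counting with multiplicity.
  degree : Subgraph → Vertex → ℕ
  degree H v = ∣ Subgraph.edges H ∩ tabulate (λ e → does (incident? v e)) ∣

  -- The null subgraph, having no vertex at all, is excluded.
  Degenerate : ℕ → Set
  Degenerate d = ∀ (H : Subgraph) → Nonempty (Subgraph.vertices H) →
    ∃[ v ] v ∈ Subgraph.vertices H × degree H v ≤ d

  IsDegeneracy : ℕ → Set
  IsDegeneracy = IsLeast Degenerate

  -- A predicate S on edges stands for the spanning subgraph with edge set S.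

  data Walk (S : Pred Edge 0ℓ) : Vertex → Vertex → Set where
    nil  : ∀ {u} → Walk S u u
    cons : ∀ {u v w} (e : Edge) → S e → Joins e u v → Walk S v w → Walk S u w

  walkEdges : ∀ {S u v} → Walk S u v → List Edge
  walkEdges nil            = []
  walkEdges (cons e _ _ p) = e ∷ walkEdges p

  -- All vertices visited, except the final one.
  walkVertices : ∀ {S u v} → Walk S u v → List Vertex
  walkVertices nil                = []
  walkVertices (cons {u} _ _ _ p) = u ∷ walkVertices p

  -- Two parallel edges form a cycle of length 2; requiring distinct edges
  -- prevents traversing one edge back and forth from counting as a cycle.
  record Cycle (S : Pred Edge 0ℓ) : Set where
    field
      base            : Vertex
      walk            : Walk S base base
      nonempty        : walkEdges walk ≢ []
      unique-edges    : Unique (walkEdges walk)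
      unique-vertices : Unique (walkVertices walk)

  -- Cycles are identified up to base point and direction.
  SameCycle : ∀ {S} → Cycle S → Cycle S → Set
  SameCycle C D = ∀ e →
    e List.∈ walkEdges (Cycle.walk C) ⇔ e List.∈ walkEdges (Cycle.walk D)

  Forest : Pred Edge 0ℓ → Set
  Forest S = ¬ Cycle S

  PseudoForest : Pred Edge 0ℓ → Set
  PseudoForest S = ∀ (C D : Cycle S) →
    Walk S (Cycle.base C) (Cycle.base D) → SameCycle C D

  -- The component of v has a centre w incident to all edges of the component;
  -- an isolated vertex counts as a (trivial) star.
  StarComponent : Pred Edge 0ℓ → Vertex → Set
  StarComponent S v = ∃[ w ] Walk S v w ×
    (∀ e → S e → Walk S v (proj₁ (ends e)) → Incident w e)

  StarForest : Pred Edge 0ℓ → Set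
  StarForest S = Forest S × (∀ v → StarComponent S v)

  PartitionInto : (Pred Edge 0ℓ → Set) → ℕ → Set
  PartitionInto P k = ∃ λ (f : Edge → Fin k) → ∀ i → P (λ e → f e ≡ i)

  IsArboricity : ℕ → Set
  IsArboricity = IsLeast (PartitionInto Forest)

  IsPseudoArboricity : ℕ → Set
  IsPseudoArboricity = IsLeast (PartitionInto PseudoForest)

  IsLSFD : ∀ {c} → (Edge → Subset c) → (Edge → Fin c) → Set
  IsLSFD Q φ = (∀ e → φ e ∈ Q e) × (∀ i → StarForest (λ e → φ e ≡ i))

  -- Finitely many finite palettes only involve finitely many colours, so the
  -- colours may be taken from Fin c for an arbitrary c.
  ListStarColourable : ℕ → Set
  ListStarColourable k = ∀ {c} (Q : Edge → Subset c) →
    (∀ e → ∣ Q e ∣ ≡ k) → ∃[ φ ] IsLSFD Q φ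

  IsListStarArboricity : ℕ → Set
  IsListStarArboricity = IsLeast ListStarColourable

module Submission where

-- Upper bound: orient the edges acyclically with outdegrees at most δ and colour them greedily, edges
-- with later tails first.  An edge u → v avoids the colours of the at most δ − 1 other edges
-- leaving u and of the at most δ edges leaving v, so 2δ colours suffice.  In a colour class no vertex
-- then has two outgoing edges and the head of an edge has none, so every component is a star
-- around a sink.
--
-- Lower bounds: a pseudo-forest on w vertices has at most w edges and a forest at most w − 1, so the
-- average degree of a subgraph is at most 2a*, and less than 2a.  The edge bounds follow by adding the
-- edges one at a time while keeping track of which components are still trees: every edge turns at
-- least one tree component into something else (it is merged away, or it acquires a cycle), because
-- otherwise two different cycles would lie in one component.

open import Data.Bool using (true; false; if_then_else_)
open import Data.Fin using (Fin; zero; suc; _≟_)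
open import Data.Fin.Properties using (any?)
open import Data.Fin.Subset
  using (Subset; _∈_; _⊆_; _∩_; _∪_; _-_; ⁅_⁆; ⊤; ∣_∣; Nonempty; inside; outside)
open import Data.Fin.Subset.Induction using (⊂-wellFounded)
open import Data.Fin.Subset.Properties
open import Data.List using (List; []; _∷_; _∷ʳ_; allFin)
import Data.List.Membership.DecPropositional as DecMembership
open import Data.List.Membership.Propositional using () renaming (_∈_ to _∈ˡ_)
open import Data.List.Membership.Propositional.Properties using (∈-allFin)
open import Data.List.Relation.Binary.Permutation.Propositional using (↭-sym; ↭⇒↭ₛ)
open import Data.List.Relation.Binary.Permutation.Propositional.Properties using (∷↭∷ʳ; ∈-resp-↭)
open import Data.List.Relation.Binary.Permutation.Setoid.Properties using (Unique-resp-↭)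
open import Data.List.Relation.Unary.All as All using (All)
open import Data.List.Relation.Unary.All.Properties using (¬Any⇒All¬)
open import Data.List.Relation.Unary.AllPairs as AllPairs using (AllPairs; []; _∷_)
open import Data.List.Relation.Unary.Any using (here; there)
open import Data.List.Relation.Unary.Sorted.TotalOrder.Properties using (Sorted⇒AllPairs)
open import Data.List.Relation.Unary.Unique.Propositional using (Unique)
open import Data.List.Relation.Unary.Unique.Propositional.Properties using (allFin⁺)
import Data.List.Sort as Sort
open import Data.Nat
  using (ℕ; zero; suc; _+_; _*_; _∸_; _⊓_; _≤_; _<_; z≤n; s≤s; s≤s⁻¹; _≤?_)
open import Data.Nat.Properties hiding (_≟_)
open import Algebra.Properties.CommutativeMonoid.Sum +-0-commutativeMonoid
  using (sum; sum-cong-≗; ∑-comm)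
open import Algebra.Properties.Semiring.Sum +-*-semiring using (*-distribˡ-sum)
open import Data.Product using (_×_; _,_; proj₁; proj₂; ∃; Σ)
open import Data.Sum using (_⊎_; inj₁; inj₂; swap)
open import Data.Vec using (tabulate; lookup; []; _∷_; there)
open import Data.Vec.Functional using (updateAt)
open import Data.Vec.Functional.Properties using (updateAt-updates; updateAt-minimal)
open import Data.Vec.Properties using ([]=⇒lookup; lookup⇒[]=; lookup∘tabulate)
open import Function using (_∘_; id; const)
open import Function.Bundles using (_⇔_; Equivalence)
open import Induction.WellFounded using (Acc; acc)
open import Level using (0ℓ)
import Relation.Binary.Construct.On as On
open import Relation.Binary.Core using (Rel)
open import Relation.Binary.PropositionalEquality
open import Relation.Nullary using (¬_; Dec; yes; no; does; contradiction)
open import Relation.Nullary.Decidable using (_×-dec_; ¬?; dec-true)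
open import Relation.Unary using (Pred; Decidable)
open import Defs

private variable
  c m n : ℕ

-- Cardinalities of finite subsets.

subset : {P : Pred (Fin n) 0ℓ} → Decidable P → Subset n
subset P? = tabulate (does ∘ P?)

module _ {P : Pred (Fin n) 0ℓ} (P? : Decidable P) where

  ∈-subset⁺ : ∀ {x} → P x → x ∈ subset P?
  ∈-subset⁺ {x} Px = lookup⇒[]= x _ (trans (lookup∘tabulate _ x) (dec-true (P? x) Px))

  ∈-subset⁻ : ∀ {x} → x ∈ subset P? → P x
  ∈-subset⁻ {x} x∈ with P? x | trans (sym (lookup∘tabulate (does ∘ P?) x)) ([]=⇒lookup x∈)
  ... | yes Px | _ = Px

∣p∪q∣≤∣p∣+∣q∣ : (p q : Subset n) → ∣ p ∪ q ∣ ≤ ∣ p ∣ + ∣ q ∣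
∣p∪q∣≤∣p∣+∣q∣ []            []            = z≤n
∣p∪q∣≤∣p∣+∣q∣ (outside ∷ p) (outside ∷ q) = ∣p∪q∣≤∣p∣+∣q∣ p q
∣p∪q∣≤∣p∣+∣q∣ (outside ∷ p) (inside  ∷ q) rewrite +-suc ∣ p ∣ ∣ q ∣ = s≤s (∣p∪q∣≤∣p∣+∣q∣ p q)
∣p∪q∣≤∣p∣+∣q∣ (inside  ∷ p) (outside ∷ q) = s≤s (∣p∪q∣≤∣p∣+∣q∣ p q)
∣p∪q∣≤∣p∣+∣q∣ (inside  ∷ p) (inside  ∷ q) =
  s≤s (≤-trans (∣p∪q∣≤∣p∣+∣q∣ p q) (+-monoʳ-≤ ∣ p ∣ (n≤1+n ∣ q ∣)))

∣p∣≤1+∣p-x∣ : (p : Subset n) (x : Fin n) → ∣ p ∣ ≤ suc ∣ p - x ∣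
∣p∣≤1+∣p-x∣ p x = begin
  ∣ p ∣                     ≤⟨ p⊆q⇒∣p∣≤∣q∣ split ⟩
  ∣ ⁅ x ⁆ ∪ (p - x) ∣       ≤⟨ ∣p∪q∣≤∣p∣+∣q∣ ⁅ x ⁆ (p - x) ⟩
  ∣ ⁅ x ⁆ ∣ + ∣ p - x ∣     ≡⟨ cong (_+ ∣ p - x ∣) (∣⁅x⁆∣≡1 x) ⟩
  suc ∣ p - x ∣             ∎
  where
  open ≤-Reasoning
  split : p ⊆ ⁅ x ⁆ ∪ (p - x)
  split {y} y∈p with y ≟ x
  ... | yes refl = x∈p∪q⁺ (inj₁ (x∈⁅x⁆ x))
  ... | no  y≢x  = x∈p∪q⁺ (inj₂ (x∈p∧x≢y⇒x∈p-y y∈p y≢x))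

x∈p-y⇒x∈p : (p : Subset n) {x y : Fin n} → x ∈ p - y → x ∈ p
x∈p-y⇒x∈p p {y = y} = p─q⊆p p ⁅ y ⁆

x∈p-y⇒x≢y : (p : Subset n) {x y : Fin n} → x ∈ p - y → x ≢ y
x∈p-y⇒x≢y (_ ∷ p) {zero}  {zero}  ()
x∈p-y⇒x≢y (_ ∷ p) {suc x} {suc y} (there x∈) refl = x∈p-y⇒x≢y p x∈ refl

x∈p⇒∣p∣>0 : {p : Subset n} {x : Fin n} → x ∈ p → 0 < ∣ p ∣
x∈p⇒∣p∣>0 x∈p = ≤-<-trans z≤n (x∈p⇒∣p-x∣<∣p∣ x∈p)

-- Indicator sums and double counting.

sum-mono-≤ : {f g : Fin n → ℕ} → (∀ i → f i ≤ g i) → sum f ≤ sum g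
sum-mono-≤ {zero}  f≤g = z≤n
sum-mono-≤ {suc n} f≤g = +-mono-≤ (f≤g zero) (sum-mono-≤ (f≤g ∘ suc))

χ : Subset n → Fin n → ℕ
χ p i = if lookup p i then 1 else 0

∣p∣≡∑χ : (p : Subset n) → ∣ p ∣ ≡ sum (χ p)
∣p∣≡∑χ []            = refl
∣p∣≡∑χ (inside  ∷ p) = cong suc (∣p∣≡∑χ p)
∣p∣≡∑χ (outside ∷ p) = ∣p∣≡∑χ p

χ-∈ : {p : Subset n} {i : Fin n} → i ∈ p → χ p i ≡ 1
χ-∈ i∈p rewrite []=⇒lookup i∈p = refl

χ-*-≤ : (p : Subset n) (i : Fin n) {a b : ℕ} → (i ∈ p → a ≤ b) → χ p i * a ≤ χ p i * b
χ-*-≤ p i a≤b with lookup p i in eq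
... | true  = *-monoʳ-≤ 1 (a≤b (lookup⇒[]= i p eq))
... | false = z≤n

χ-≤ : (p : Subset n) (i : Fin n) {b : ℕ} → (i ∈ p → 1 ≤ b) → χ p i ≤ b
χ-≤ p i 1≤b with lookup p i in eq
... | true  = 1≤b (lookup⇒[]= i p eq)
... | false = z≤n

χ-*-χ-≤ : (p : Subset n) (i : Fin n) (q : Subset m) (j : Fin m) {b : ℕ} →
  (i ∈ p → j ∈ q → 1 ≤ b) → χ p i * χ q j ≤ b
χ-*-χ-≤ p i q j 1≤b with lookup p i in eq
... | true  = ≤-trans (≤-reflexive (*-identityˡ _)) (χ-≤ q j (1≤b (lookup⇒[]= i p eq)))
... | false = z≤n

-- The pairs with `i ∈ p` and `j ∈ row i` number at least `∣ p ∣ * a`; by `transpose` they are among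
-- the pairs with `j ∈ q` and `i ∈ col j`, of which there are at most `∣ q ∣ * b`. Indicator
-- functions turn both counts into double sums, which `∑-comm` exchanges.
double-counting : (p : Subset m) (q : Subset n)
  (row : Fin m → Subset n) (col : Fin n → Subset m) (a b : ℕ) →
  (∀ {i j} → i ∈ p → j ∈ row i → j ∈ q × i ∈ col j) →
  (∀ {i} → i ∈ p → a ≤ ∣ row i ∣) → (∀ {j} → j ∈ q → ∣ col j ∣ ≤ b) →
  ∣ p ∣ * a ≤ ∣ q ∣ * b
double-counting {m} {n} p q row col a b transpose a≤row col≤b = begin
  ∣ p ∣ * a                                 ≡⟨ expand p a ⟩
  sum (λ i → χ p i * a)                     ≤⟨ sum-mono-≤ (λ i → χ-*-≤ p i a≤row) ⟩
  sum (λ i → χ p i * ∣ row i ∣)             ≡⟨ sum-cong-≗ (λ i → expand₂ (χ p i) (row i)) ⟩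
  sum (λ i → sum λ j → χ p i * χ (row i) j) ≤⟨ sum-mono-≤ (λ i → sum-mono-≤ (λ j → entry i j)) ⟩
  sum (λ i → sum λ j → χ q j * χ (col j) i) ≡⟨ ∑-comm (λ i j → χ q j * χ (col j) i) ⟩
  sum (λ j → sum λ i → χ q j * χ (col j) i) ≡⟨ sum-cong-≗ (λ j → expand₂ (χ q j) (col j)) ⟨
  sum (λ j → χ q j * ∣ col j ∣)             ≤⟨ sum-mono-≤ (λ j → χ-*-≤ q j col≤b) ⟩
  sum (λ j → χ q j * b)                     ≡⟨ expand q b ⟨
  ∣ q ∣ * b                                 ∎
  where
  open ≤-Reasoning
  expand₂ : ∀ {k} c (r : Subset k) → c * ∣ r ∣ ≡ sum (λ j → c * χ r j)
  expand₂ c r = trans (cong (c *_) (∣p∣≡∑χ r)) (*-distribˡ-sum c (χ r))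
  expand : ∀ {k} (r : Subset k) c → ∣ r ∣ * c ≡ sum (λ i → χ r i * c)
  expand r c = trans (*-comm ∣ r ∣ c)
    (trans (expand₂ c r) (sum-cong-≗ (λ i → *-comm c (χ r i))))
  entry : ∀ i j → χ p i * χ (row i) j ≤ χ q j * χ (col j) i
  entry i j = χ-*-χ-≤ p i (row i) j λ i∈p j∈row →
    let j∈q , i∈col = transpose i∈p j∈row in
    ≤-reflexive (sym (cong₂ _*_ (χ-∈ j∈q) (χ-∈ i∈col)))

0<∣p∣⇒Nonempty : (p : Subset n) → 0 < ∣ p ∣ → Nonempty p
0<∣p∣⇒Nonempty {n} p 0<∣p∣ with nonempty? p
... | yes nonempty = nonempty
... | no  empty    =
  contradiction (trans (cong ∣_∣ (Empty-unique empty)) (∣⊥∣≡0 n)) (m<n⇒n≢0 0<∣p∣)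

-- Greedy list colouring in a prescribed order.

AllPairs-map-∈ : {A : Set} {R S : Rel A 0ℓ} {xs : List A} →
  (∀ {x y} → x ∈ˡ xs → y ∈ˡ xs → R x y → S x y) → AllPairs R xs → AllPairs S xs
AllPairs-map-∈ R⇒S []         = []
AllPairs-map-∈ R⇒S (Rx ∷ Rxs) =
  All.tabulate (λ y∈ → R⇒S (here refl) (there y∈) (All.lookup Rx y∈))
  ∷ AllPairs-map-∈ (λ x∈ y∈ → R⇒S (there x∈) (there y∈)) Rxs

AllPairs-lookup : {A : Set} {R : Rel A 0ℓ} {xs : List A} {x y : A} →
  AllPairs R xs → x ∈ˡ xs → y ∈ˡ xs → x ≢ y → R x y ⊎ R y x
AllPairs-lookup (_  ∷ _)   (here refl) (here refl) x≢y = contradiction refl x≢y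
AllPairs-lookup (Rx ∷ _)   (here refl) (there y∈)  _   = inj₁ (All.lookup Rx y∈)
AllPairs-lookup (Ry ∷ _)   (there x∈)  (here refl) _   = inj₂ (All.lookup Ry x∈)
AllPairs-lookup (_  ∷ Rxs) (there x∈)  (there y∈)  x≢y = AllPairs-lookup Rxs x∈ y∈ x≢y

module GreedyColouring (Q : Fin n → Subset c) (conflict : Fin n → Subset n)
                       (room : ∀ e → ∣ conflict e ∣ < ∣ Q e ∣) where

  -- Otherwise every colour of `Q e` is blocked by some element of `conflict e`, while each such
  -- element blocks only its own colour. Double counting with both bounds 1 then gives
  -- `∣ Q e ∣ ≤ ∣ conflict e ∣`, against `room`.
  freeColour : (φ : Fin n → Fin c) (e : Fin n) →
    ∃ λ x → x ∈ Q e × (∀ {f} → f ∈ conflict e → φ f ≢ x)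
  freeColour φ e with any? (λ x → x ∈? Q e ×-dec ¬? (any? λ f → f ∈? conflict e ×-dec φ f ≟ x))
  ... | yes (x , x∈Q , free) = x , x∈Q , λ f∈ φf≡x → free (_ , f∈ , φf≡x)
  ... | no  noneFree         = contradiction (room e) (≤⇒≯ ∣Q∣≤∣conflict∣)
    where
    blocks? : ∀ x f → Dec (f ∈ conflict e × φ f ≡ x)
    blocks? x f = f ∈? conflict e ×-dec φ f ≟ x
    blockers : Fin c → Subset n
    blockers x = subset (blocks? x)
    blocked : ∀ {x} → x ∈ Q e → 1 ≤ ∣ blockers x ∣
    blocked {x} x∈Q with any? (blocks? x)
    ... | yes (_ , blocks) = x∈p⇒∣p∣>0 (∈-subset⁺ (blocks? x) blocks)
    ... | no  free         = contradiction (x , x∈Q , free) noneFree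
    ∣Q∣≤∣conflict∣ : ∣ Q e ∣ ≤ ∣ conflict e ∣
    ∣Q∣≤∣conflict∣ = subst₂ _≤_ (*-identityʳ _) (*-identityʳ _)
      (double-counting (Q e) (conflict e) blockers (λ f → ⁅ φ f ⁆) 1 1
        (λ {x} _ f∈ → let f∈conflict , φf≡x = ∈-subset⁻ (blocks? x) f∈ in
          f∈conflict , subst (_∈ ⁅ φ _ ⁆) φf≡x (x∈⁅x⁆ _))
        blocked (λ {f} _ → ≤-reflexive (∣⁅x⁆∣≡1 (φ f))))

  -- The list is coloured from its end, so only conflicts with later entries matter.
  colourList : (es : List (Fin n)) → Unique es → ∃ λ (φ : Fin n → Fin c) →
    (∀ e → φ e ∈ Q e) × AllPairs (λ e f → f ∈ conflict e → φ f ≢ φ e) es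
  -- The colouring is total from the outset, with arbitrary colours from the palettes, which `room`
  -- makes nonempty; list entries are recoloured one by one.
  colourList [] [] = (λ e → proj₁ (some e)) , (λ e → proj₂ (some e)) , []
    where
    some : ∀ e → Nonempty (Q e)
    some e = 0<∣p∣⇒Nonempty (Q e) (≤-<-trans z≤n (room e))
  colourList (e ∷ es) (e∉es ∷ unique)
    with φ , φ∈Q , ok ← colourList es unique
    with x , x∈Q , free ← freeColour φ e = φ′ , φ′∈Q , new ∷ AllPairs-map-∈ keep ok
    where
    φ′ : Fin n → Fin c
    φ′ = updateAt φ e (const x)
    φ′e : φ′ e ≡ x
    φ′e = updateAt-updates e φ
    φ′-old : ∀ {f} → f ≢ e → φ′ f ≡ φ f
    φ′-old {f} f≢e = updateAt-minimal f e φ f≢e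
    φ′∈Q : ∀ f → φ′ f ∈ Q f
    φ′∈Q f with f ≟ e
    ... | yes refl = subst (_∈ Q e) (sym φ′e) x∈Q
    ... | no  f≢e  = subst (_∈ Q f) (sym (φ′-old f≢e)) (φ∈Q f)
    ∈⇒≢ : ∀ {f} → f ∈ˡ es → f ≢ e
    ∈⇒≢ f∈es refl = All.lookup e∉es f∈es refl
    new : All (λ f → f ∈ conflict e → φ′ f ≢ φ′ e) es
    new = All.tabulate λ f∈es f∈ eq →
      free f∈ (trans (sym (φ′-old (∈⇒≢ f∈es))) (trans eq φ′e))
    keep : ∀ {f g} → f ∈ˡ es → g ∈ˡ es →
      (g ∈ conflict f → φ g ≢ φ f) → g ∈ conflict f → φ′ g ≢ φ′ f
    keep f∈ g∈ g≢f g∈conflict eq =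
      g≢f g∈conflict (trans (sym (φ′-old (∈⇒≢ g∈))) (trans eq (φ′-old (∈⇒≢ f∈))))

module _ (G : LooplessMultigraph) where
  open LooplessMultigraph G
  open Cycle

  private variable
    S T : Pred Edge 0ℓ
    u v w x y : Vertex
    e f : Edge

  -- Walks, paths and cycles.

  _⟫_ : Walk G S u v → Walk G S v w → Walk G S u w
  nil            ⟫ q = q
  cons e e∈S j p ⟫ q = cons e e∈S j (p ⟫ q)

  reverse : Walk G S u v → Walk G S v u
  reverse nil              = nil
  reverse (cons e e∈S j p) = reverse p ⟫ cons e e∈S (swap j) nil

  module _ (S⊆T : ∀ {e} → S e → T e) where

    mapWalk : Walk G S u v → Walk G T u v
    mapWalk nil              = nil
    mapWalk (cons e e∈S j p) = cons e (S⊆T e∈S) j (mapWalk p)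

    walkEdges-map : (p : Walk G S u v) → walkEdges G (mapWalk p) ≡ walkEdges G p
    walkEdges-map nil            = refl
    walkEdges-map (cons e _ _ p) = cong (e ∷_) (walkEdges-map p)

    walkVertices-map : (p : Walk G S u v) → walkVertices G (mapWalk p) ≡ walkVertices G p
    walkVertices-map nil                = refl
    walkVertices-map (cons {u} _ _ _ p) = cong (u ∷_) (walkVertices-map p)

    mapCycle : Cycle G S → Cycle G T
    mapCycle C .base            = C .base
    mapCycle C .walk            = mapWalk (C .walk)
    mapCycle C .nonempty        = C .nonempty ∘ trans (sym (walkEdges-map (C .walk)))
    mapCycle C .unique-edges    = subst Unique (sym (walkEdges-map (C .walk))) (C .unique-edges)
    mapCycle C .unique-vertices =
      subst Unique (sym (walkVertices-map (C .walk))) (C .unique-vertices)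

    PseudoForest-antitone : PseudoForest G T → PseudoForest G S
    PseudoForest-antitone pf C D p e =
      subst₂ (λ es fs → e ∈ˡ es ⇔ e ∈ˡ fs) (walkEdges-map (C .walk)) (walkEdges-map (D .walk))
        (pf (mapCycle C) (mapCycle D) (mapWalk p) e)

    Forest-antitone : Forest G T → Forest G S
    Forest-antitone acyclic C = acyclic (mapCycle C)

  Forest⇒PseudoForest : Forest G S → PseudoForest G S
  Forest⇒PseudoForest acyclic C = contradiction C acyclic

  walkEdges⊆ : (p : Walk G S u v) → e ∈ˡ walkEdges G p → S e
  walkEdges⊆ (cons e e∈S _ p) (here refl) = e∈S
  walkEdges⊆ (cons _ _   _ p) (there e∈p) = walkEdges⊆ p e∈p

  visited : Walk G S u v → List Vertex
  visited {v = v} p = walkVertices G p ∷ʳ v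

  start∈visited : (p : Walk G S u v) → u ∈ˡ visited p
  start∈visited nil            = here refl
  start∈visited (cons _ _ _ p) = here refl

  Joins-incident : Joins G e u v → Incident G x e → x ≡ u ⊎ x ≡ v
  Joins-incident (inj₁ refl) inc = inc
  Joins-incident (inj₂ refl) inc = swap inc

  incidentˡ : Joins G e u v → Incident G u e
  incidentˡ (inj₁ refl) = inj₁ refl
  incidentˡ (inj₂ refl) = inj₂ refl

  Joins-cong : {A : Set} (g : Vertex → A) → Joins G e u v → g u ≡ g v →
    g (proj₁ (ends e)) ≡ g (proj₂ (ends e))
  Joins-cong g (inj₁ refl) gu≡gv = gu≡gv
  Joins-cong g (inj₂ refl) gu≡gv = sym gu≡gv

  incident⇒visited : (p : Walk G S u v) → e ∈ˡ walkEdges G p → Incident G x e → x ∈ˡ visited p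
  incident⇒visited (cons _ _ j p) (here refl) inc with Joins-incident j inc
  ... | inj₁ refl = here refl
  ... | inj₂ refl = there (start∈visited p)
  incident⇒visited (cons _ _ _ p) (there e∈p) inc = there (incident⇒visited p e∈p inc)

  IsPath : Walk G S u v → Set
  IsPath p = Unique (visited p)

  suffix : (p : Walk G S u v) → IsPath p → x ∈ˡ visited p → Σ (Walk G S x v) IsPath
  suffix nil              path       (here refl) = nil , path
  suffix (cons e e∈S j p) path       (here refl) = cons e e∈S j p , path
  suffix (cons _ _   _ p) (_ ∷ path) (there x∈p) = suffix p path x∈p

  -- If the new start `u` already lies on the path `q`, the detour back to `u` is dropped.
  toPath : Walk G S u v → Σ (Walk G S u v) IsPath
  toPath nil = nil , All.[] ∷ []
  toPath (cons {u} e e∈S j p) with toPath p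
  ... | q , path with DecMembership._∈?_ _≟_ u (visited q)
  ...   | yes u∈q = suffix q path u∈q
  ...   | no  u∉q = cons e e∈S j q , ¬Any⇒All¬ _ u∉q ∷ path

  path⇒unique-edges : (p : Walk G S u v) → IsPath p → Unique (walkEdges G p)
  path⇒unique-edges nil            _            = []
  path⇒unique-edges (cons e _ j p) (u∉p ∷ path) =
    -- A second use of `e` would make `p` visit `u` again.
    All.tabulate (λ { e∈p refl → All.lookup u∉p (incident⇒visited p e∈p (incidentˡ j)) refl })
    ∷ path⇒unique-edges p path

  -- The cycle crosses `e` from `v` to `u` and returns along a path in `S`, which avoids `e` because
  -- `e` is not in `S`.
  closePath : (∀ {e} → S e → T e) → ¬ S e → T e → Joins G e u v → Walk G S u v →
    ∃ λ (C : Cycle G T) → C .base ≡ v × e ∈ˡ walkEdges G (C .walk)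
  closePath {S} {T} {e} {u} {v} S⊆T e∉S e∈T j p with toPath p
  ... | q , path = C , refl , here refl
    where
    C : Cycle G T
    C .base            = v
    C .walk            = cons e e∈T (swap j) (mapWalk S⊆T q)
    C .nonempty        ()
    C .unique-edges    rewrite walkEdges-map S⊆T q =
      All.tabulate (λ { e∈q refl → e∉S (walkEdges⊆ q e∈q) }) ∷ path⇒unique-edges q path
    C .unique-vertices rewrite walkVertices-map S⊆T q =
      -- The cycle lists `v` first and the path lists it last; otherwise the vertex lists agree.
      Unique-resp-↭ (setoid _) (↭⇒↭ₛ (↭-sym (∷↭∷ʳ v (walkVertices G q)))) path

  cycle-edge : (C : Cycle G S) → ∃ λ e → e ∈ˡ walkEdges G (C .walk)
  cycle-edge C with walkEdges G (C .walk) | C .nonempty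
  ... | []    | ne = contradiction refl ne
  ... | e ∷ _ | _  = e , here refl

  -- Edge bounds for forests and pseudo-forests.

  -- The label of a vertex names its component in the graph (W , F); size bounds the number of edges
  -- because every edge added uses up one of the ∣ W ∣ initial tree components.
  record Components (W : Subset #V) (F : Subset #E) : Set where
    field
      label      : Vertex → Vertex
      treeLabels : Subset #V
      size       : ∣ F ∣ + ∣ treeLabels ∣ ≤ ∣ W ∣
      label⇒walk : label u ≡ label v → Walk G (_∈ F) u v
      edge⇒label : e ∈ F → label (proj₁ (ends e)) ≡ label (proj₂ (ends e))
      treeOrCycle : v ∈ W →
        label v ∈ treeLabels ⊎ ∃ λ (C : Cycle G (_∈ F)) → label (C .base) ≡ label v

    Joins⇒label : e ∈ F → Joins G e u v → label u ≡ label v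
    Joins⇒label e∈F (inj₁ refl) = edge⇒label e∈F
    Joins⇒label e∈F (inj₂ refl) = sym (edge⇒label e∈F)

    -- A walk never leaves its component. Hence an edge common to two cycles forces them into the
    -- same component, as `addEdge` exploits.
    walkEdge⇒label : (p : Walk G (_∈ F) u v) → e ∈ˡ walkEdges G p → label (proj₁ (ends e)) ≡ label u
    walkEdge⇒label (cons e e∈F (inj₁ refl) p) (here refl) = refl
    walkEdge⇒label (cons e e∈F (inj₂ refl) p) (here refl) = edge⇒label e∈F
    walkEdge⇒label (cons _ e∈F j p)           (there e∈p) =
      trans (walkEdge⇒label p e∈p) (sym (Joins⇒label e∈F j))

  module _ {W : Subset #V} {F : Subset #E} {e : Edge} (e∈F : e ∈ F)
           (pf : PseudoForest G (_∈ F)) (K : Components W (F - e)) where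
    open Components K

    private
      F-e⊆F : ∀ {f} → f ∈ F - e → f ∈ F
      F-e⊆F = x∈p-y⇒x∈p F

      -- The one edge that `F` has beyond `F - e` is paid for by the tree label given up.
      size-step : {x : Vertex} → x ∈ treeLabels → ∣ F ∣ + ∣ treeLabels - x ∣ ≤ ∣ W ∣
      size-step {x} x∈L = begin
        ∣ F ∣ + ∣ treeLabels - x ∣           ≤⟨ +-monoˡ-≤ _ (∣p∣≤1+∣p-x∣ F e) ⟩
        suc ∣ F - e ∣ + ∣ treeLabels - x ∣   ≡⟨ +-suc ∣ F - e ∣ _ ⟨
        ∣ F - e ∣ + suc ∣ treeLabels - x ∣   ≤⟨ +-monoʳ-≤ ∣ F - e ∣ (x∈p⇒∣p-x∣<∣p∣ x∈L) ⟩
        ∣ F - e ∣ + ∣ treeLabels ∣           ≤⟨ size ⟩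
        ∣ W ∣                                ∎
        where open ≤-Reasoning

      edge-cases : ∀ {f} → f ∈ F → f ≡ e ⊎ f ∈ F - e
      edge-cases {f} f∈F with f ≟ e
      ... | yes f≡e = inj₁ f≡e
      ... | no  f≢e = inj₂ (x∈p∧x≢y⇒x∈p-y f∈F f≢e)

    -- Adding `e` inside a component creates a cycle `C` through `e`. If the component already had a
    -- cycle `D`, the pseudo-forest condition would put `e` on `D`, which lies in `F - e`. So the
    -- component still has a tree label, and `C` replaces it.
    closeCycle : u ∈ W → Joins G e u v → label u ≡ label v → Components W F
    closeCycle {u} {v} u∈W j ℓu≡ℓv
      with C , refl , e∈C ← closePath F-e⊆F (λ e∈ → x∈p-y⇒x≢y F e∈ refl) e∈F j (label⇒walk ℓu≡ℓv)
      with treeOrCycle u∈W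
    ... | inj₂ (D , ℓD≡ℓu) = contradiction e∈F-e λ e∈ → x∈p-y⇒x≢y F e∈ refl
      where
      e∈D : e ∈ˡ walkEdges G (mapWalk F-e⊆F (D .walk))
      e∈D = Equivalence.to
        (pf C (mapCycle F-e⊆F D) (mapWalk F-e⊆F (label⇒walk (sym (trans ℓD≡ℓu ℓu≡ℓv)))) e) e∈C
      e∈F-e : e ∈ F - e
      e∈F-e = walkEdges⊆ (D .walk) (subst (e ∈ˡ_) (walkEdges-map F-e⊆F (D .walk)) e∈D)
    ... | inj₁ ℓu∈L = record
      { label       = label
      ; treeLabels  = treeLabels - label u
      ; size        = size-step ℓu∈L
      ; label⇒walk  = mapWalk F-e⊆F ∘ label⇒walk
      ; edge⇒label  = edge⇒label′
      ; treeOrCycle = treeOrCycle′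
      }
      where
      edge⇒label′ : ∀ {f} → f ∈ F → label (proj₁ (ends f)) ≡ label (proj₂ (ends f))
      edge⇒label′ f∈F with edge-cases f∈F
      ... | inj₂ f∈   = edge⇒label f∈
      ... | inj₁ refl = Joins-cong label j ℓu≡ℓv
      treeOrCycle′ : ∀ {x} → x ∈ W →
        label x ∈ treeLabels - label u ⊎ ∃ λ (D : Cycle G (_∈ F)) → label (D .base) ≡ label x
      treeOrCycle′ {x} x∈W with label x ≟ label u | treeOrCycle x∈W
      ... | yes ℓx≡ℓu | _              = inj₂ (C , sym (trans ℓx≡ℓu ℓu≡ℓv))
      ... | no  ℓx≢ℓu | inj₁ ℓx∈L      = inj₁ (x∈p∧x≢y⇒x∈p-y ℓx∈L ℓx≢ℓu)
      ... | no  _     | inj₂ (D , eq)  = inj₂ (mapCycle F-e⊆F D , eq)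

    -- Joining two components spends the tree label of `u`. The union takes the label of `v` and
    -- inherits the status of that component, whether a tree label or a cycle.
    merge : v ∈ W → Joins G e u v → label u ≢ label v → label u ∈ treeLabels → Components W F
    merge {v} {u} v∈W j ℓu≢ℓv ℓu∈L = record
      { label       = relabel ∘ label
      ; treeLabels  = treeLabels - label u
      ; size        = size-step ℓu∈L
      ; label⇒walk  = label⇒walk′
      ; edge⇒label  = edge⇒label′
      ; treeOrCycle = treeOrCycle′
      }
      where
      relabel : Vertex → Vertex
      relabel y = if does (y ≟ label u) then label v else y

      relabel-u : relabel (label u) ≡ label v
      relabel-u with label u ≟ label u
      ... | yes _ = refl
      ... | no  ≢ = contradiction refl ≢

      relabel-≢ : y ≢ label u → relabel y ≡ y
      relabel-≢ {y} y≢ with y ≟ label u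
      ... | yes y≡ = contradiction y≡ y≢
      ... | no  _  = refl

      uv : relabel (label u) ≡ relabel (label v)
      uv = trans relabel-u (sym (relabel-≢ (ℓu≢ℓv ∘ sym)))

      old : label x ≡ label y → Walk G (_∈ F) x y
      old = mapWalk F-e⊆F ∘ label⇒walk

      label⇒walk′ : relabel (label x) ≡ relabel (label y) → Walk G (_∈ F) x y
      label⇒walk′ {x} {y} eq with label x ≟ label u | label y ≟ label u
      ... | yes x~u | yes y~u = old (trans x~u (sym y~u))
      ... | yes x~u | no  _   = old x~u ⟫ cons e e∈F j (old eq)
      ... | no  _   | yes y~u = old eq ⟫ cons e e∈F (swap j) (old (sym y~u))
      ... | no  _   | no  _   = old eq

      edge⇒label′ : ∀ {f} → f ∈ F → relabel (label (proj₁ (ends f))) ≡ relabel (label (proj₂ (ends f)))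
      edge⇒label′ f∈F with edge-cases f∈F
      ... | inj₂ f∈   = cong relabel (edge⇒label f∈)
      ... | inj₁ refl = Joins-cong (relabel ∘ label) j uv

      TreeOrCycle′ : Vertex → Set
      TreeOrCycle′ y = y ∈ treeLabels - label u ⊎ ∃ λ (C : Cycle G (_∈ F)) → relabel (label (C .base)) ≡ y

      unmerged : x ∈ W → label x ≢ label u → TreeOrCycle′ (label x)
      unmerged x∈W ℓx≢ℓu with treeOrCycle x∈W
      ... | inj₁ ℓx∈L     = inj₁ (x∈p∧x≢y⇒x∈p-y ℓx∈L ℓx≢ℓu)
      ... | inj₂ (C , eq) = inj₂ (mapCycle F-e⊆F C , trans (cong relabel eq) (relabel-≢ ℓx≢ℓu))

      treeOrCycle′ : x ∈ W → TreeOrCycle′ (relabel (label x))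
      treeOrCycle′ {x} x∈W with label x ≟ label u
      ... | yes _     = unmerged v∈W (ℓu≢ℓv ∘ sym)
      ... | no  ℓx≢ℓu = unmerged x∈W ℓx≢ℓu

    addEdge : u ∈ W → v ∈ W → Joins G e u v → Components W F
    addEdge {u} {v} u∈W v∈W j with label u ≟ label v | treeOrCycle u∈W | treeOrCycle v∈W
    ... | yes ℓu≡ℓv | _         | _         = closeCycle u∈W j ℓu≡ℓv
    ... | no  ℓu≢ℓv | inj₁ ℓu∈L | _         = merge v∈W j ℓu≢ℓv ℓu∈L
    ... | no  ℓu≢ℓv | inj₂ _    | inj₁ ℓv∈L = merge u∈W (swap j) (ℓu≢ℓv ∘ sym) ℓv∈L
    -- Both components have cycles. Within `F` the edge `e` connects them, so `C` and `D` have the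
    -- same edges; an edge of `C` that lies on `D` forces equal labels.
    ... | no  ℓu≢ℓv | inj₂ (C , ℓC≡ℓu) | inj₂ (D , ℓD≡ℓv) = contradiction ℓu≡ℓv ℓu≢ℓv
      where
      C′ D′ : Cycle G (_∈ F)
      C′ = mapCycle F-e⊆F C
      D′ = mapCycle F-e⊆F D
      bridge : Walk G (_∈ F) (C .base) (D .base)
      bridge = mapWalk F-e⊆F (label⇒walk ℓC≡ℓu)
        ⟫ cons e e∈F j (mapWalk F-e⊆F (label⇒walk (sym ℓD≡ℓv)))
      e₀ : Edge
      e₀ = proj₁ (cycle-edge C)
      e₀∈D : e₀ ∈ˡ walkEdges G (D .walk)
      e₀∈D = subst (e₀ ∈ˡ_) (walkEdges-map F-e⊆F (D .walk)) (Equivalence.to (pf C′ D′ bridge e₀)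
        (subst (e₀ ∈ˡ_) (sym (walkEdges-map F-e⊆F (C .walk))) (proj₂ (cycle-edge C))))
      ℓu≡ℓv : label u ≡ label v
      ℓu≡ℓv = trans (sym ℓC≡ℓu) (trans (sym (walkEdge⇒label (C .walk) (proj₂ (cycle-edge C))))
        (trans (walkEdge⇒label (D .walk) e₀∈D) ℓD≡ℓv))

  Within : Subset #E → Subset #V → Set
  Within F W = ∀ {e v} → e ∈ F → Incident G v e → v ∈ W

  components : (W : Subset #V) (F : Subset #E) → Within F W → PseudoForest G (_∈ F) → Components W F
  components W F = go F (⊂-wellFounded F)
    where
    go : ∀ F → Acc _ F → Within F W → PseudoForest G (_∈ F) → Components W F
    go F (acc rec) within pf with nonempty? F
    ... | yes (e , e∈F) = addEdge e∈F pf
      (go (F - e) (rec (x∈p⇒p-x⊂p e∈F)) (within ∘ x∈p-y⇒x∈p F) (PseudoForest-antitone (x∈p-y⇒x∈p F) pf))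
      (within e∈F (inj₁ refl)) (within e∈F (inj₂ refl)) (inj₁ refl)
    -- Without edges each vertex of `W` is a tree labelled by itself, so `size` holds with equality.
    ... | no  empty = record
      { label       = id
      ; treeLabels  = W
      ; size        = ≤-reflexive (cong (_+ ∣ W ∣) (trans (cong ∣_∣ (Empty-unique empty)) (∣⊥∣≡0 #E)))
      ; label⇒walk  = λ { refl → nil }
      ; edge⇒label  = λ e∈F → contradiction (_ , e∈F) empty
      ; treeOrCycle = inj₁
      }

  pseudoForest-size : (W : Subset #V) (F : Subset #E) → Within F W → PseudoForest G (_∈ F) →
    ∣ F ∣ ≤ ∣ W ∣
  pseudoForest-size W F within pf = m+n≤o⇒m≤o ∣ F ∣ (Components.size (components W F within pf))

  -- In the absence of cycles the component of `v` still holds a tree label, which accounts for the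
  -- strict inequality.
  forest-size : (W : Subset #V) (F : Subset #E) → Nonempty W → Within F W → Forest G (_∈ F) →
    ∣ F ∣ < ∣ W ∣
  forest-size W F (v , v∈W) within acyclic = begin
    suc ∣ F ∣             ≡⟨ +-comm 1 ∣ F ∣ ⟩
    ∣ F ∣ + 1             ≤⟨ +-monoʳ-≤ ∣ F ∣ (x∈p⇒∣p∣>0 ℓv∈L) ⟩
    ∣ F ∣ + ∣ treeLabels ∣ ≤⟨ size ⟩
    ∣ W ∣                 ∎
    where
    open ≤-Reasoning
    open Components (components W F within (Forest⇒PseudoForest acyclic))
    ℓv∈L : label v ∈ treeLabels
    ℓv∈L with treeOrCycle v∈W
    ... | inj₁ ∈L      = ∈L
    ... | inj₂ (C , _) = contradiction C acyclic

  -- Star-forests from orientations.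

  module StarOrientation (tail head : Edge → Vertex) (joins : ∀ e → Joins G e (tail e) (head e))
    (S : Pred Edge 0ℓ) (S? : Decidable S)
    (tail-injective : ∀ {e f} → S e → S f → tail e ≡ tail f → e ≡ f)
    (head-sink : ∀ {e f} → S e → S f → tail f ≢ head e) where

    orient : Joins G e u v → (u ≡ tail e × v ≡ head e) ⊎ (u ≡ head e × v ≡ tail e)
    orient {e} j with joins e | j
    ... | inj₁ p | inj₁ q = inj₁ (cong proj₁ r , cong proj₂ r) where r = trans (sym q) p
    ... | inj₂ p | inj₂ q = inj₁ (cong proj₂ r , cong proj₁ r) where r = trans (sym q) p
    ... | inj₁ p | inj₂ q = inj₂ (cong proj₂ r , cong proj₁ r) where r = trans (sym q) p
    ... | inj₂ p | inj₁ q = inj₂ (cong proj₁ r , cong proj₂ r) where r = trans (sym q) p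

    -- At the meeting point of two distinct edges, a common tail contradicts `tail-injective`, and a
    -- head of one that is the tail of the other contradicts `head-sink`.
    common-head : S e → S f → e ≢ f → Joins G e u v → Joins G f v w → v ≡ head e × v ≡ head f
    common-head e∈S f∈S e≢f j k with orient j | orient k
    ... | inj₁ (_ , v≡he) | inj₂ (v≡hf , _) = v≡he , v≡hf
    ... | inj₁ (_ , v≡he) | inj₁ (v≡tf , _) = contradiction (trans (sym v≡tf) v≡he) (head-sink e∈S f∈S)
    ... | inj₂ (_ , v≡te) | inj₁ (v≡tf , _) =
      contradiction (tail-injective e∈S f∈S (trans (sym v≡te) v≡tf)) e≢f
    ... | inj₂ (_ , v≡te) | inj₂ (v≡hf , _) = contradiction (trans (sym v≡te) v≡hf) (head-sink f∈S e∈S)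

    Joins⇒≢ : Joins G e u v → u ≢ v
    Joins⇒≢ {e} (inj₁ refl) = loopless e
    Joins⇒≢ {e} (inj₂ refl) = loopless e ∘ sym

    -- Consecutive edges meet at a common head, so an edge with such meetings at both ends would be
    -- a loop. In length 2 the same two edges meet twice; in greater length the first three edges
    -- suffice.
    no-closed-trail : (p : Walk G S u u) → walkEdges G p ≢ [] → ¬ Unique (walkEdges G p)
    no-closed-trail nil ne _ = ne refl
    no-closed-trail (cons e _ j nil) _ _ = Joins⇒≢ j refl
    no-closed-trail (cons e e∈S j (cons f f∈S k nil)) _ ((e≢f All.∷ _) ∷ _) =
      Joins⇒≢ k (trans (proj₁ (common-head e∈S f∈S e≢f j k))
        (sym (proj₂ (common-head f∈S e∈S (e≢f ∘ sym) k j))))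
    no-closed-trail (cons e e∈S j (cons f f∈S k (cons g g∈S l _))) _
                    ((e≢f All.∷ _) ∷ (f≢g All.∷ _) ∷ _) =
      Joins⇒≢ k (trans (proj₂ (common-head e∈S f∈S e≢f j k))
        (sym (proj₁ (common-head f∈S g∈S f≢g k l))))

    -- The centre `w` of the star containing `x`, described by the edges leaving `x` alone: `x` is
    -- the sink, or an edge leads from it to `w`. In this local form it can be carried along a walk
    -- edge by edge.
    data Centre (w x : Vertex) : Set where
      itself : w ≡ x → (∀ {e} → S e → tail e ≢ x) → Centre w x
      leaf   : ∀ {e} → S e → tail e ≡ x → head e ≡ w → Centre w x

    centre-step : S e → Joins G e x y → Centre w x → Centre w y
    centre-step e∈S j c with orient j | c
    ... | inj₁ (x≡te , _)    | itself _ sink         = contradiction (sym x≡te) (sink e∈S)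
    -- The only edge leaving a leaf leads to the centre, which is a sink because it is a head.
    ... | inj₁ (x≡te , y≡he) | leaf f∈S tf≡x hf≡w
      with refl ← tail-injective f∈S e∈S (trans tf≡x x≡te) =
      itself (trans (sym hf≡w) (sym y≡he)) (λ g∈S tg≡y → head-sink e∈S g∈S (trans tg≡y y≡he))
    ... | inj₂ (x≡he , y≡te) | itself w≡x _          = leaf e∈S (sym y≡te) (trans (sym x≡he) (sym w≡x))
    ... | inj₂ (x≡he , _)    | leaf f∈S tf≡x _       = contradiction (trans tf≡x x≡he) (head-sink e∈S f∈S)

    centre-walk : Walk G S x y → Centre w x → Centre w y
    centre-walk nil              c = c
    centre-walk (cons _ e∈S j p) c = centre-walk p (centre-step e∈S j c)

    centre-incident : S e → Centre w (proj₁ (ends e)) → Incident G w e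
    centre-incident e∈S (itself w≡x _) = inj₁ w≡x
    centre-incident {e} e∈S c@(leaf _ _ _) with centre-step e∈S (inj₁ refl) c
    ... | itself w≡y _ = inj₂ w≡y
    ... | leaf f∈S tf≡y hf≡w with c
    ...   | itself w≡x _ = inj₁ w≡x
    -- With `leaf` at both ends, the first end cannot be the head of `e`, so `e` is the edge leaving
    -- it and ends at `w`.
    ...   | leaf g∈S tg≡x hg≡w with orient {e} (inj₁ refl)
    ...     | inj₁ (x≡te , _) with refl ← tail-injective g∈S e∈S (trans tg≡x x≡te) =
      subst (λ z → Incident G z e) hg≡w (incidentˡ (swap (joins e)))
    ...     | inj₂ (x≡he , _) = contradiction (trans tg≡x x≡he) (head-sink e∈S g∈S)

    hasCentre : ∀ x → ∃ λ w → Walk G S x w × Centre w x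
    hasCentre x with any? (λ e → S? e ×-dec tail e ≟ x)
    ... | yes (e , e∈S , refl) = head e , cons e e∈S (joins e) nil , leaf e∈S refl refl
    ... | no  sink             = x , nil , itself refl (λ e∈S te≡x → sink (_ , e∈S , te≡x))

    starForest : StarForest G S
    starForest = (λ C → no-closed-trail (C .walk) (C .nonempty) (C .unique-edges)) , component
      where
      component : ∀ x → StarComponent G S x
      component x with w , p , c ← hasCentre x =
        w , p , λ e e∈S q → centre-incident e∈S (centre-walk q c)

  -- Acyclic orientations from degeneracy.

  Inside : Subset #V → Edge → Set
  Inside W e = proj₁ (ends e) ∈ W × proj₂ (ends e) ∈ W

  inside? : ∀ W e → Dec (Inside W e)
  inside? W e = proj₁ (ends e) ∈? W ×-dec proj₂ (ends e) ∈? W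

  induced : Subset #V → Subgraph G
  induced W .Subgraph.vertices = W
  induced W .Subgraph.edges    = subset (inside? W)
  induced W .Subgraph.closed e∈ (inj₁ refl) = proj₁ (∈-subset⁻ (inside? W) e∈)
  induced W .Subgraph.closed e∈ (inj₂ refl) = proj₂ (∈-subset⁻ (inside? W) e∈)

  LowEnd : (Vertex → ℕ) → Vertex → Edge → Set
  LowEnd r v e = Incident G v e × r v ≤ r (proj₁ (ends e)) × r v ≤ r (proj₂ (ends e))

  lowEnd? : ∀ r v e → Dec (LowEnd r v e)
  lowEnd? r v e = incident? G v e ×-dec r v ≤? r (proj₁ (ends e)) ×-dec r v ≤? r (proj₂ (ends e))

  insideLowEnd? : ∀ r W v e → Dec (Inside W e × LowEnd r v e)
  insideLowEnd? r W v e = inside? W e ×-dec lowEnd? r v e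

  -- A degeneracy ordering of `W`: vertices deleted earlier get lower rank, and each edge is charged
  -- to the end deleted first.
  record Elimination (d : ℕ) (W : Subset #V) : Set where
    field
      rank       : Vertex → ℕ
      rank-ends  : ∀ {e} → Inside W e → rank (proj₁ (ends e)) ≢ rank (proj₂ (ends e))
      few-higher : ∀ {v} → v ∈ W → ∣ subset (insideLowEnd? rank W v) ∣ ≤ d

  -- `v` receives rank 0 and all others move up by one. Every edge at `v` inside `W` then has its
  -- low end there, which costs the degree of `v`; an edge with another low end cannot touch `v`, so
  -- the bound for `W - v` still applies.
  eliminate : ∀ {d W v} → v ∈ W → degree G (induced W) v ≤ d →
    Elimination d (W - v) → Elimination d W
  eliminate {d} {W} {v} v∈W deg≤d E = record
    { rank = rank′ ; rank-ends = rank-ends′ ; few-higher = few-higher′ }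
    where
    open Elimination E
    rank′ : Vertex → ℕ
    rank′ x with x ≟ v
    ... | yes _ = 0
    ... | no  _ = suc (rank x)

    rank′-≢ : x ≢ v → rank′ x ≡ suc (rank x)
    rank′-≢ {x} x≢v with x ≟ v
    ... | yes x≡v = contradiction x≡v x≢v
    ... | no  _   = refl

    rank-ends′ : ∀ {e} → Inside W e → rank′ (proj₁ (ends e)) ≢ rank′ (proj₂ (ends e))
    rank-ends′ {e} (p∈W , q∈W) eq with proj₁ (ends e) ≟ v | proj₂ (ends e) ≟ v
    ... | yes p≡v | yes q≡v = loopless e (trans p≡v (sym q≡v))
    ... | yes p≡v | no  q≢v = 0≢1+n eq
    ... | no  p≢v | yes q≡v = 0≢1+n (sym eq)
    ... | no  p≢v | no  q≢v =
      rank-ends (x∈p∧x≢y⇒x∈p-y p∈W p≢v , x∈p∧x≢y⇒x∈p-y q∈W q≢v) (suc-injective eq)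

    higher : x ≢ v → rank′ x ≤ rank′ y → y ≢ v × rank x ≤ rank y
    higher {x} {y} x≢v le rewrite rank′-≢ x≢v with y ≟ v
    ... | no y≢v = y≢v , s≤s⁻¹ le

    few-higher′ : ∀ {x} → x ∈ W → ∣ subset (insideLowEnd? rank′ W x) ∣ ≤ d
    few-higher′ {x} x∈W = by-cases (x ≟ v)
      where
      by-cases : Dec (x ≡ v) → ∣ subset (insideLowEnd? rank′ W x) ∣ ≤ d
      by-cases (yes refl) = ≤-trans (p⊆q⇒∣p∣≤∣q∣ λ e∈ →
        let ins , inc , _ = ∈-subset⁻ (insideLowEnd? rank′ W x) e∈ in
        x∈p∩q⁺ (∈-subset⁺ (inside? W) ins , ∈-subset⁺ (incident? G x) inc)) deg≤d
      by-cases (no x≢v) = ≤-trans (p⊆q⇒∣p∣≤∣q∣ λ e∈ →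
        let (p∈W , q∈W) , inc , x≤p , x≤q = ∈-subset⁻ (insideLowEnd? rank′ W x) e∈
            p≢v , x≤p′ = higher x≢v x≤p
            q≢v , x≤q′ = higher x≢v x≤q
        in ∈-subset⁺ (insideLowEnd? rank (W - v) x)
             ((x∈p∧x≢y⇒x∈p-y p∈W p≢v , x∈p∧x≢y⇒x∈p-y q∈W q≢v) , inc , x≤p′ , x≤q′))
        (few-higher (x∈p∧x≢y⇒x∈p-y x∈W x≢v))

  elimination : ∀ {d} → Degenerate G d → ∀ W → Elimination d W
  elimination {d} degenerate W = go W (⊂-wellFounded W)
    where
    go : ∀ W → Acc _ W → Elimination d W
    go W (acc rec) with nonempty? W
    ... | yes nonempty with v , v∈W , deg≤d ← degenerate (induced W) nonempty =
      eliminate v∈W deg≤d (go (W - v) (rec (x∈p⇒p-x⊂p v∈W)))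
    ... | no  empty = record
      { rank       = const 0
      ; rank-ends  = λ (p∈W , _) → contradiction (_ , p∈W) empty
      ; few-higher = λ v∈W → contradiction (_ , v∈W) empty
      }

  -- Acyclicity is witnessed by a rank increasing along every edge; the same rank later orders the
  -- colouring.
  record AcyclicOrientation (d : ℕ) : Set where
    field
      tail head : Edge → Vertex
      joins     : ∀ e → Joins G e (tail e) (head e)
      rank      : Vertex → ℕ
      ascending : ∀ e → rank (tail e) < rank (head e)

    out : Vertex → Subset #E
    out v = subset (λ e → tail e ≟ v)

    ∈-out : ∀ {e v} → tail e ≡ v → e ∈ out v
    ∈-out {v = v} = ∈-subset⁺ (λ e → tail e ≟ v)

    field
      outdegree : ∀ v → ∣ out v ∣ ≤ d

  -- Each edge points from lower to higher rank, so every edge leaving `v` has its low end at `v`.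
  orientation : ∀ {d} → Degenerate G d → AcyclicOrientation d
  orientation {d} degenerate = record
    { tail      = λ e → proj₁ (oriented e)
    ; head      = λ e → proj₁ (proj₂ (oriented e))
    ; joins     = λ e → proj₁ (proj₂ (proj₂ (oriented e)))
    ; rank      = rank
    ; ascending = λ e → proj₂ (proj₂ (proj₂ (oriented e)))
    ; outdegree = λ v → ≤-trans (p⊆q⇒∣p∣≤∣q∣ (out⊆lowEnd v)) (few-higher {v} ∈⊤)
    }
    where
    open Elimination (elimination degenerate ⊤)
    oriented : ∀ e → ∃ λ u → ∃ λ v → Joins G e u v × rank u < rank v
    oriented e with rank (proj₁ (ends e)) ≤? rank (proj₂ (ends e))
    ... | yes ≤ = _ , _ , inj₁ refl , ≤∧≢⇒< ≤ (rank-ends (∈⊤ , ∈⊤))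
    ... | no  ≰ = _ , _ , inj₂ refl , ≰⇒> ≰
    lowEnd : Joins G e u v → rank u < rank v → LowEnd rank u e
    lowEnd (inj₁ refl) u<v = inj₁ refl , ≤-refl , <⇒≤ u<v
    lowEnd (inj₂ refl) u<v = inj₂ refl , <⇒≤ u<v , ≤-refl
    out⊆lowEnd : ∀ v → subset (λ e → proj₁ (oriented e) ≟ v)
               ⊆ subset (insideLowEnd? rank ⊤ v)
    out⊆lowEnd v {e} e∈ with refl ← ∈-subset⁻ (λ e → proj₁ (oriented e) ≟ v) e∈ =
      let _ , _ , j , u<v = oriented e in ∈-subset⁺ (insideLowEnd? rank ⊤ v) ((∈⊤ , ∈⊤) , lowEnd j u<v)

  -- List star colouring of an acyclically oriented graph.

  module _ {d : ℕ} (O : AcyclicOrientation d) where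
    open AcyclicOrientation O

    private
      conflict : Edge → Subset #E
      conflict e = (out (tail e) ∪ out (head e)) - e

      ∣conflict∣<2d : ∀ e → ∣ conflict e ∣ < 2 * d
      ∣conflict∣<2d e = begin
        -- `e` itself lies in `out (tail e)`, and its removal makes the bound strict.
        suc ∣ conflict e ∣                    ≤⟨ x∈p⇒∣p-x∣<∣p∣ (x∈p∪q⁺ (inj₁ (∈-out refl))) ⟩
        ∣ out (tail e) ∪ out (head e) ∣       ≤⟨ ∣p∪q∣≤∣p∣+∣q∣ (out (tail e)) (out (head e)) ⟩
        ∣ out (tail e) ∣ + ∣ out (head e) ∣   ≤⟨ +-mono-≤ (outdegree (tail e)) (outdegree (head e)) ⟩
        d + d                                 ≡⟨ cong (d +_) (+-identityʳ d) ⟨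
        2 * d                                 ∎
        where open ≤-Reasoning

      tail-order = On.decTotalOrder ≤-decTotalOrder (rank ∘ tail)
      open Sort tail-order

      -- Tail ranks increase along the list and the colouring starts from its end, so the edges
      -- leaving `head e` are coloured before `e`.
      edges : List Edge
      edges = sort (allFin #E)

      edges-unique : Unique edges
      edges-unique = Unique-resp-↭ (setoid _) (↭⇒↭ₛ (↭-sym (sort-↭ _))) (allFin⁺ #E)

      ∈-edges : ∀ e → e ∈ˡ edges
      ∈-edges e = ∈-resp-↭ (↭-sym (sort-↭ _)) (∈-allFin e)

      edges-sorted : AllPairs (λ e f → rank (tail e) ≤ rank (tail f)) edges
      edges-sorted = Sorted⇒AllPairs (On.totalOrder ≤-totalOrder (rank ∘ tail)) (sort-↗ _)

    listStarColourable : ListStarColourable G (2 * d)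
    listStarColourable Q ∣Q∣≡2d
      with φ , φ∈Q , ok ← GreedyColouring.colourList Q conflict
             (λ e → subst (∣ conflict e ∣ <_) (sym (∣Q∣≡2d e)) (∣conflict∣<2d e)) edges edges-unique
      = φ , φ∈Q , λ i → StarOrientation.starForest tail head joins (λ e → φ e ≡ i) (λ e → φ e ≟ i)
          (λ { refl φf≡φe → tail-injective (sym φf≡φe) })
          (λ { refl φf≡φe → head-sink φf≡φe })
      where
      ordered : AllPairs (λ e f → rank (tail e) ≤ rank (tail f) × (f ∈ conflict e → φ f ≢ φ e)) edges
      ordered = AllPairs.zip (edges-sorted , ok)

      conflict-tail : e ≢ f → tail f ≡ tail e → f ∈ conflict e
      conflict-tail e≢f eq = x∈p∧x≢y⇒x∈p-y (x∈p∪q⁺ (inj₁ (∈-out eq))) (e≢f ∘ sym)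

      tail-injective : φ e ≡ φ f → tail e ≡ tail f → e ≡ f
      tail-injective {e} {f} same eq with e ≟ f
      ... | yes e≡f = e≡f
      -- Edges with a common tail conflict in both directions, so either order in the list refutes
      -- equal colours.
      ... | no  e≢f with AllPairs-lookup ordered (∈-edges e) (∈-edges f) e≢f
      ...   | inj₁ (_ , ≢) = contradiction (sym same) (≢ (conflict-tail e≢f (sym eq)))
      ...   | inj₂ (_ , ≢) = contradiction same (≢ (conflict-tail (e≢f ∘ sym) eq))

      head-sink : φ f ≡ φ e → tail f ≢ head e
      head-sink {f} {e} same eq with AllPairs-lookup ordered (∈-edges e) (∈-edges f) e≢f
        where
        e≢f : e ≢ f
        e≢f refl = <-irrefl (cong rank eq) (ascending e)
      ... | inj₁ (_ , ≢) = ≢ (x∈p∧x≢y⇒x∈p-y (x∈p∪q⁺ (inj₂ (∈-out eq)))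
        λ { refl → <-irrefl (cong rank eq) (ascending e) }) same
      -- If `f` came before `e`, the rank of `head e` would be at most that of `tail e`, against
      -- `ascending`.
      ... | inj₂ (f≤e , _) = <⇒≱ (subst (rank (tail e) <_) (cong rank (sym eq)) (ascending e)) f≤e

  -- Degeneracy bounds from edge counts.

  handshake : ∀ {d} (H : Subgraph G) → let open Subgraph H in
    (∀ {v} → v ∈ vertices → d ≤ degree G H v) → ∣ vertices ∣ * d ≤ ∣ edges ∣ * 2
  handshake {d} H d≤deg = double-counting vertices edges
    (λ v → edges ∩ subset (incident? G v)) (λ e → subset (λ v → incident? G v e)) d 2
    (λ {v} {e} _ e∈ → let e∈E , inc = x∈p∩q⁻ edges _ e∈ in
      e∈E , ∈-subset⁺ (λ v → incident? G v e) (∈-subset⁻ (incident? G v) inc))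
    d≤deg (λ {e} _ → two-ends e)
    where
    open Subgraph H
    two-ends : ∀ e → ∣ subset (λ v → incident? G v e) ∣ ≤ 2
    two-ends e = begin
      ∣ subset (λ v → incident? G v e) ∣   ≤⟨ p⊆q⇒∣p∣≤∣q∣ sub ⟩
      ∣ ⁅ p ⁆ ∪ ⁅ q ⁆ ∣                    ≤⟨ ∣p∪q∣≤∣p∣+∣q∣ ⁅ p ⁆ ⁅ q ⁆ ⟩
      ∣ ⁅ p ⁆ ∣ + ∣ ⁅ q ⁆ ∣                ≡⟨ cong₂ _+_ (∣⁅x⁆∣≡1 p) (∣⁅x⁆∣≡1 q) ⟩
      2                                    ∎
      where
      open ≤-Reasoning
      p q : Vertex
      p = proj₁ (ends e)
      q = proj₂ (ends e)
      sub : subset (λ v → incident? G v e) ⊆ ⁅ p ⁆ ∪ ⁅ q ⁆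
      sub v∈ with ∈-subset⁻ (λ v → incident? G v e) v∈
      ... | inj₁ refl = x∈p∪q⁺ (inj₁ (x∈⁅x⁆ _))
      ... | inj₂ refl = x∈p∪q⁺ (inj₂ (x∈⁅x⁆ _))

  -- If all vertices of `H` had degree at least `suc d`, counting incidences would contradict
  -- `sparse`.
  degenerate : ∀ {d} → (∀ (H : Subgraph G) → let open Subgraph H in
    Nonempty vertices → ∣ edges ∣ * 2 < ∣ vertices ∣ * suc d) → Degenerate G d
  degenerate {d} sparse H nonempty with any? (λ v → v ∈? Subgraph.vertices H ×-dec degree G H v ≤? d)
  ... | yes found = found
  ... | no  none  = contradiction
    (handshake H (λ v∈ → ≰⇒> (λ deg≤d → none (_ , v∈ , deg≤d)))) (<⇒≱ (sparse H nonempty))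

  -- Each edge lies in the one part given by `f`, and each part restricted to `H` has at most `b`
  -- edges; `antitone` makes `P` survive the restriction.
  partition-size : ∀ {P : Pred Edge 0ℓ → Set} {k b} →
    (∀ {S T} → (∀ {e} → S e → T e) → P T → P S) → PartitionInto G P k → (H : Subgraph G) →
    (∀ F → Within F (Subgraph.vertices H) → P (_∈ F) → ∣ F ∣ ≤ b) →
    ∣ Subgraph.edges H ∣ ≤ k * b
  partition-size {P} {k} {b} antitone (f , parts) H bound = begin
    ∣ edges ∣       ≡⟨ *-identityʳ _ ⟨
    ∣ edges ∣ * 1   ≤⟨ double-counting edges ⊤ (λ e → ⁅ f e ⁆) part 1 b
                         (λ {e} e∈E i∈ → ∈⊤ , x∈p∩q⁺ (e∈E , ∈-subset⁺ (part? _) (sym (x∈⁅y⁆⇒x≡y _ i∈))))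
                         (λ {e} _ → ≤-reflexive (sym (∣⁅x⁆∣≡1 (f e))))
                         (λ {i} _ → bound (part i)
                           (λ e∈ → closed (proj₁ (x∈p∩q⁻ edges _ e∈)))
                           (antitone (λ e∈ → ∈-subset⁻ (part? i) (proj₂ (x∈p∩q⁻ edges _ e∈))) (parts i))) ⟩
    ∣ ⊤ {k} ∣ * b   ≡⟨ cong (_* b) (∣⊤∣≡n k) ⟩
    k * b           ∎
    where
    open ≤-Reasoning
    open Subgraph H
    part? : ∀ i e → Dec (f e ≡ i)
    part? i e = f e ≟ i
    part : Fin k → Subset #E
    part i = edges ∩ subset (part? i)

  pseudoForests⇒degenerate : ∀ {k} → PartitionInto G (PseudoForest G) k → Degenerate G (2 * k)
  pseudoForests⇒degenerate {k} partition = degenerate λ H nonempty →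
    let open Subgraph H
        |W| = ∣ vertices ∣ in begin-strict
    ∣ edges ∣ * 2       ≤⟨ *-monoˡ-≤ 2 (partition-size (PseudoForest-antitone) partition H
                             (pseudoForest-size vertices)) ⟩
    k * |W| * 2         ≡⟨ *-comm (k * |W|) 2 ⟩
    2 * (k * |W|)       ≡⟨ *-assoc 2 k |W| ⟨
    2 * k * |W|         ≡⟨ *-comm (2 * k) |W| ⟩
    |W| * (2 * k)       <⟨ m<n+m _ (x∈p⇒∣p∣>0 (proj₂ nonempty)) ⟩
    |W| + |W| * (2 * k) ≡⟨ *-suc |W| (2 * k) ⟨
    |W| * suc (2 * k)   ∎
    where open ≤-Reasoning

  -- A forest has one edge fewer than the bound for a pseudo-forest, which leaves enough room to
  -- lower the degeneracy bound by one.
  forests⇒degenerate : ∀ {k} → PartitionInto G (Forest G) k → Degenerate G (2 * k ∸ 1)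
  forests⇒degenerate {k} partition = degenerate λ H nonempty →
    sparse (x∈p⇒∣p∣>0 (proj₂ nonempty)) (partition-size (Forest-antitone) partition H
      λ F within acyclic → <⇒≤pred (forest-size (Subgraph.vertices H) F nonempty within acyclic))
    where
    sparse : ∀ {m w} → 0 < w → m ≤ k * (w ∸ 1) → m * 2 < w * suc (2 * k ∸ 1)
    sparse {m} {suc w} _ m≤kw = begin-strict
      m * 2                               ≤⟨ *-monoˡ-≤ 2 m≤kw ⟩
      k * w * 2                           ≡⟨ *-comm (k * w) 2 ⟩
      2 * (k * w)                         ≡⟨ *-assoc 2 k w ⟨
      2 * k * w                           ≡⟨ *-comm (2 * k) w ⟩
      -- `suc (2 * k ∸ 1)` is `2 * k` for positive `k`, but 1 for `k` equal to 0, where the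
      -- subtraction truncates.
      w * (2 * k)                         ≤⟨ *-monoʳ-≤ w (m≤n+m∸n (2 * k) 1) ⟩
      w * suc (2 * k ∸ 1)                 <⟨ m<n+m _ (s≤s z≤n) ⟩
      suc w * suc (2 * k ∸ 1)             ∎
      where open ≤-Reasoning

theoremE3 : (G : LooplessMultigraph) (δ a a* aˡ : ℕ) →
    IsDegeneracy G δ → IsArboricity G a → IsPseudoArboricity G a* →
    IsListStarArboricity G aˡ →
    -- ∸ truncates only for a ≡ 0, i.e. for an edgeless graph, where both sides of the last ≤ are 0
    (aˡ ≤ 2 * δ) × (2 * δ ≤ (4 * a*) ⊓ (4 * a ∸ 2))
theoremE3 G δ a a* aˡ (degenerate-δ , δ-least) (forests , _) (pseudoForests , _) (_ , aˡ-least) =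
  aˡ-least (2 * δ) (listStarColourable G (orientation G degenerate-δ)) ,
  ⊓-glb
    (begin
      2 * δ         ≤⟨ *-monoʳ-≤ 2 (δ-least (2 * a*) (pseudoForests⇒degenerate G pseudoForests)) ⟩
      2 * (2 * a*)  ≡⟨ *-assoc 2 2 a* ⟨
      4 * a*        ∎)
    (begin
      2 * δ             ≤⟨ *-monoʳ-≤ 2 (δ-least (2 * a ∸ 1) (forests⇒degenerate G forests)) ⟩
      2 * (2 * a ∸ 1)   ≡⟨ *-distribˡ-∸ 2 (2 * a) 1 ⟩
      2 * (2 * a) ∸ 2   ≡⟨ cong (_∸ 2) (*-assoc 2 2 a) ⟨
      4 * a ∸ 2         ∎)
  where open ≤-Reasoning
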